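{- Let $r\ge 2$ be an integer, and define $a:\mathbb{Z}\to\mathbb{Z}$ by $a(n)=\left\lfloor \frac{n}{\sqrt{r}}+\frac{\sqrt{r}}{2}\right\rfloor$, and $S(n)=\sum_{j=0}^{r-1}a(n-j)$. If $r$ is not an even perfect square (i.e. not of the form $r=s^2$ with $s$ even), then $a(S(n))=n$ for all integers $n\ge r$. If $r=s^{2}$ with $s$ even, then $a(S(n))=n+1$ for all integers $n\ge r$. In particular, when $r=s^2$ with $s$ odd, $a(S(n))=n$ for all $n\ge r$. -}

module Defs where

open import Data.Nat as ℕ using (ℕ)
open import Data.Nat.Divisibility using (_∣_)
open import Data.Integer using (ℤ; +_; _+_; _-_; _*_; _≤_; _<_; 0ℤ)
open import Data.List using (map; upTo; foldr)
open import Data.Product using (_×_; Σ)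
open import Data.Sum using (_⊎_)
open import Relation.Binary.PropositionalEquality using (_≡_)
open import Relation.Nullary using (¬_)

LeMulSqrt : ℕ → ℤ → ℤ → Set
LeMulSqrt R u N =
    (u ≤ 0ℤ × 0ℤ ≤ N)
  ⊎ (u ≤ 0ℤ × N < 0ℤ × N * N ≤ u * u * + R)
  ⊎ (0ℤ < u × 0ℤ ≤ N × u * u * + R ≤ N * N)

-- m ≤ n/√r + √r/2 = (2n + r)/(2√r)  ⇔  m · √(4r) ≤ 2n + r
FloorLe : ℕ → ℤ → ℤ → Set
FloorLe r m n = LeMulSqrt (4 ℕ.* r) m (+ 2 * n + + r)

IsFloorValue : ℕ → ℤ → ℤ → Set
IsFloorValue r n m = FloorLe r m n × ¬ FloorLe r (m + + 1) n

IsA : ℕ → (ℤ → ℤ) → Set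
IsA r a = ∀ n → IsFloorValue r n (a n)

sumℤ : Data.List.List ℤ → ℤ
sumℤ = foldr _+_ 0ℤ

S : ℕ → (ℤ → ℤ) → ℤ → ℤ
S r a n = sumℤ (map (λ j → a (n - + j)) (upTo r))

EvenSquare : ℕ → Set
EvenSquare r = Σ ℕ (λ s → r ≡ s ℕ.* s × 2 ∣ s)

OddSquare : ℕ → Set
OddSquare r = Σ ℕ (λ s → r ≡ s ℕ.* s × ¬ (2 ∣ s))

{-# OPTIONS --safe #-}

-- The value a(S n) is n precisely when n√r ≤ S n + r/2 < (n + 1)√r. The upper bound S n + r/2 ≤ (n + 1)√r,
-- for all integers n, is the heart of the matter: the r summands of S n form at most ⌊√r⌋ + 2 blocks on which
-- a is constant, starting at c(k) = ⌈k√r - r/2⌉, so S n is an explicit expression minus a sum of consecutive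
-- excesses θ(k) = c(k) - k√r + r/2, and that sum is large because θ(k + 1) - θ(k) + √r is an integer and
-- all θ are nonnegative. The reflection a(i) + a(-r - i) ≥ -1 turns the upper bound at -n - 1 into the lower
-- bound at n. Equality in the upper bound makes r an even square; for an even square h² the sharper
-- reflection a(i) + a(h - 1 - r - i) = 0 gives equality. All inequalities take place in ℤ[√(4r)], realised as
-- pairs of integers.
module Submission where

open import Defs
import Data.Nat
open import Data.Nat as ℕ using (ℕ; zero; suc; NonZero)
open import Data.Integer using (ℤ; +_; -[1+_]; -_; _+_; _-_; _≤_; _<_; 0ℤ; 1ℤ; -1ℤ; ∣_∣; +≤+; +<+; positive; nonNegative)
open import Data.Product using (_×_; _,_; proj₁; proj₂; Σ)
open import Relation.Binary.PropositionalEquality using (_≡_; refl; sym; trans; cong; cong₂; subst; subst₂)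
open import Relation.Nullary using (¬_; yes; no; contradiction; Dec)
open import Relation.Nullary.Decidable using (map′; _×-dec_; _⊎-dec_; dec⇒maybe)
open import Algebra.Solver.Ring.AlmostCommutativeRing using (AlmostCommutativeRing; fromCommutativeRing; _-Raw-AlmostCommutative⟶_)
open import Algebra.Structures using (IsCommutativeRing)
open import Data.Empty using (⊥; ⊥-elim)
import Data.Integer as ℤ
import Data.Integer.Divisibility.Signed as ℤ∣
import Data.Integer.Properties as ℤₚ
open import Data.List using (applyUpTo)
open import Data.List.Properties using (map-applyUpTo)
open import Data.Nat.Coprimality using (Coprime; GCD≡1⇒coprime; coprime-divisor)
open import Data.Nat.Divisibility using (_∣_; divides; ∣-refl; ∣m⇒∣m*n)
open import Data.Nat.GCD using (gcd; GCD; module GCD; gcd-GCD; GCD-*)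
open import Data.Nat.Primality using (euclidsLemma; prime[2])
import Data.Nat.Properties as ℕₚ
open import Data.Sum using (_⊎_; inj₁; inj₂; [_,_]′)
open import Data.Unit using (⊤; tt)
open import Function using (id)

-- Integer arithmetic and its order

-- Opaque, since a transparent ℤ-product duplicates both factors (in sign and absolute value) when it
-- unfolds, which makes comparing nested products exponential.
infixl 7 _*_
opaque
  _*_ : ℤ → ℤ → ℤ
  _*_ = ℤ._*_

  *≡ : ∀ x y → x * y ≡ x ℤ.* y
  *≡ x y = refl

  isCommutativeRing : IsCommutativeRing _≡_ _+_ _*_ -_ 0ℤ 1ℤ
  isCommutativeRing = ℤₚ.+-*-isCommutativeRing

ring : AlmostCommutativeRing _ _
ring = fromCommutativeRing (record { isCommutativeRing = isCommutativeRing })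

morphism : ℤ.+-*-rawRing -Raw-AlmostCommutative⟶ ring
morphism = record
  { ⟦_⟧ = λ x → x
  ; +-homo = λ _ _ → refl
  ; *-homo = λ x y → sym (*≡ x y)
  ; -‿homo = λ _ → refl
  ; 0-homo = refl
  ; 1-homo = refl
  }

open import Algebra.Solver.Ring ℤ.+-*-rawRing ring morphism (λ x y → dec⇒maybe (x ℤₚ.≟ y)) using (solve; _:*_; _:+_; _:-_; :-_; _:=_; con; Polynomial)

infix 10 #_
#_ : ∀ {n} → ℕ → Polynomial n
# k = con (+ k)

0≤_ : ∀ n → 0ℤ ≤ + n
0≤ n = +≤+ ℕ.z≤n

≡-nonneg : ∀ {x y} → x ≡ y → 0ℤ ≤ x → 0ℤ ≤ y
≡-nonneg = subst (0ℤ ≤_)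

+-nonneg : ∀ {x y} → 0ℤ ≤ x → 0ℤ ≤ y → 0ℤ ≤ x + y
+-nonneg = ℤₚ.+-mono-≤

opaque
  unfolding _*_

  *-nonneg : ∀ {x y} → 0ℤ ≤ x → 0ℤ ≤ y → 0ℤ ≤ x * y
  *-nonneg {x} {y} p q = subst (_≤ x * y) (ℤₚ.*-zeroʳ x)
    (ℤₚ.*-monoˡ-≤-nonNeg x {{nonNegative p}} q)

  sq-nonneg : ∀ x → 0ℤ ≤ x * x
  sq-nonneg (+ n)    = ≡-nonneg (ℤₚ.pos-* n n) (+≤+ ℕ.z≤n)
  sq-nonneg -[1+ n ] = +≤+ ℕ.z≤n

  sq-cancel-≤ : ∀ {p q} → 0ℤ ≤ q → 0ℤ ≤ q * q - p * p → 0ℤ ≤ q - p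
  sq-cancel-≤ {p} {q} 0≤q h with p ℤₚ.≤? q
  ... | yes p≤q = ℤₚ.i≤j⇒0≤j-i p≤q
  ... | no  p≰q = contradiction (ℤₚ.0≤i-j⇒j≤i h) (ℤₚ.<⇒≱ q²<p²)
    where
    q<p : q < p
    q<p = ℤₚ.≰⇒> p≰q
    q²<p² : q * q < p * p
    q²<p² = ℤₚ.≤-<-trans
      (ℤₚ.*-monoˡ-≤-nonNeg q {{nonNegative 0≤q}} (ℤₚ.<⇒≤ q<p))
      (ℤₚ.*-monoʳ-<-pos p {{positive (ℤₚ.≤-<-trans 0≤q q<p)}} q<p)

  neg-distribˡ-* : ∀ x y → - (x * y) ≡ - x * y
  neg-distribˡ-* = ℤₚ.neg-distribˡ-*

  neg-distribʳ-* : ∀ x y → - (x * y) ≡ x * - y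
  neg-distribʳ-* = ℤₚ.neg-distribʳ-*

  *-pos-cancel : ∀ {m x} → 0ℤ < m → 0ℤ ≤ m * x → 0ℤ ≤ x
  *-pos-cancel {m} {x} 0<m h = ℤₚ.*-cancelˡ-≤-pos 0ℤ x m {{positive 0<m}}
    (subst (_≤ m * x) (sym (ℤₚ.*-zeroʳ m)) h)

  *-pos : ∀ {x y} → 0ℤ < x → 0ℤ < y → 0ℤ < x * y
  *-pos {x} {y} p q = subst (_< x * y) (ℤₚ.*-zeroʳ x) (ℤₚ.*-monoˡ-<-pos x {{positive p}} q)

-- The form of most contradictions below: a ring identity makes a nonnegative and a positive term
-- sum to zero.
no-cancellation : ∀ {x y} → 0ℤ ≤ x → 0ℤ < y → x + y ≡ 0ℤ → ⊥
no-cancellation p q eq = ℤₚ.<-irrefl (sym eq) (ℤₚ.+-mono-≤-< p q)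

nonneg-total : ∀ x → 0ℤ ≤ x ⊎ 0ℤ ≤ - x
nonneg-total x with ℤₚ.≤-total 0ℤ x
... | inj₁ p = inj₁ p
... | inj₂ p = inj₂ (ℤₚ.neg-mono-≤ p)

-- Discreteness of ℤ: the second case is x ≤ -1, kept as a nonnegative expression so that it can
-- enter sums and products.
0≤-dec : ∀ x → 0ℤ ≤ x ⊎ 0ℤ ≤ -1ℤ - x
0≤-dec (+ n)    = inj₁ (+≤+ ℕ.z≤n)
0≤-dec -[1+ n ] = inj₂ (+≤+ ℕ.z≤n)

2*-mono : ∀ {x y} → x ≤ y → + 2 * x ≤ + 2 * y
2*-mono {x} {y} x≤y = ℤₚ.0≤i-j⇒j≤i (≡-nonneg
  (solve 2 (λ x y → # 2 :* (y :- x) := # 2 :* y :- # 2 :* x) refl x y)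
  (*-nonneg (0≤ 2) (ℤₚ.i≤j⇒0≤j-i x≤y)))

<-suc : ∀ {x y} → x < y → x + 1ℤ ≤ y
<-suc {x} {y} x<y = subst (_≤ y) (ℤₚ.+-comm 1ℤ x) (ℤₚ.i<j⇒suc[i]≤j x<y)

<-pred : ∀ {x y} → x < y → x ≤ y - 1ℤ
<-pred {x} {y} x<y = subst (x ≤_) (ℤₚ.+-comm -1ℤ y) (ℤₚ.i<j⇒i≤pred[j] x<y)

suc-≤⇒< : ∀ {x y} → x + 1ℤ ≤ y → x < y
suc-≤⇒< {x} {y} h = ℤₚ.suc[i]≤j⇒i<j (subst (_≤ y) (ℤₚ.+-comm x 1ℤ) h)

+-suc-assoc : ∀ k j → k + + suc j ≡ k + + j + 1ℤ
+-suc-assoc k j = solve 2 (λ k j → k :+ (# 1 :+ j) := k :+ j :+ # 1) refl k (+ j)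

half-nonneg : ∀ {y} → 0ℤ ≤ + 2 * y + 1ℤ → 0ℤ ≤ y
half-nonneg {y} h with 0≤-dec y
... | inj₁ p = p
... | inj₂ p = ⊥-elim (no-cancellation (+-nonneg h (*-nonneg (0≤ 2) p)) (+<+ (ℕ.s≤s (ℕ.z≤n {0})))
  (solve 1 (λ y → # 2 :* y :+ # 1 :+ # 2 :* (con -1ℤ :- y) :+ # 1 := # 0) refl y))

-- The ordered ring ℤ[√R]

-- Nonneg x u means u√R ≤ x. Writing N(x , u) = x² - R u², this holds iff (0 ≤ x and 0 ≤ N) or
-- (u ≤ 0 and N ≤ 0); in this form products are immediate, as N is multiplicative.
module QuadraticOrder (R : ℤ) (0<R : 0ℤ < R) where

  0≤R : 0ℤ ≤ R
  0≤R = ℤₚ.<⇒≤ 0<R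

  norm : ℤ → ℤ → ℤ
  norm x u = x * x - R * (u * u)

  -- Named, like `Irrational`, after the term of x - u√R that dominates in absolute value.
  record Rational (x u : ℤ) : Set where
    constructor _,_
    field
      sign : 0ℤ ≤ x
      size : 0ℤ ≤ norm x u

  record Irrational (x u : ℤ) : Set where
    constructor _,_
    field
      sign : 0ℤ ≤ - u
      size : 0ℤ ≤ - norm x u

  Nonneg : ℤ → ℤ → Set
  Nonneg x u = Rational x u ⊎ Irrational x u

  cast : ∀ {x u x′ u′} → x ≡ x′ → u ≡ u′ → Nonneg x u → Nonneg x′ u′
  cast refl refl p = p

  both-nonneg : ∀ {x u} → 0ℤ ≤ x → 0ℤ ≤ - u → Nonneg x u
  both-nonneg {x} {u} p q with nonneg-total (norm x u)
  ... | inj₁ n = inj₁ (p , n)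
  ... | inj₂ n = inj₂ (q , n)

  norm-neg : ∀ x u → norm x u ≡ norm (- x) (- u)
  norm-neg x u = solve 3 (λ R x u → x :* x :- R :* (u :* u)
      := (:- x) :* (:- x) :- R :* ((:- u) :* (:- u))) refl R x u

  total : ∀ x u → Nonneg x u ⊎ Nonneg (- x) (- u)
  total x u with nonneg-total (norm x u) | nonneg-total x | nonneg-total u
  ... | inj₁ n | inj₁ p | _      = inj₁ (inj₁ (p , n))
  ... | inj₁ n | inj₂ p | _      = inj₂ (inj₁ (p , ≡-nonneg (norm-neg x u) n))
  ... | inj₂ n | _      | inj₂ q = inj₁ (inj₂ (q , n))
  ... | inj₂ n | _      | inj₁ q = inj₂ (inj₂
    (≡-nonneg (sym (ℤₚ.neg-involutive u)) q , ≡-nonneg (cong -_ (norm-neg x u)) n))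

  private
    rational-conj : ∀ {x u} → Rational x u → Rational x (- u)
    rational-conj {x} {u} (p , m) = p ,
      ≡-nonneg (solve 3 (λ R x u → x :* x :- R :* (u :* u) := x :* x :- R :* (:- u :* :- u)) refl R x u) m

    irrational-conj : ∀ {x u} → Irrational x u → Irrational (- x) u
    irrational-conj {x} {u} (p , m) = p ,
      ≡-nonneg (solve 3 (λ R x u → :- (x :* x :- R :* (u :* u))
          := :- (:- x :* :- x :- R :* (u :* u))) refl R x u) m

    -- (xy)² - (Ruv)² = N(x , u) y² + R u² N(y , v), so comparing squares suffices. The next two
    -- lemmas split a difference of squares in the same way.
    cross₁₁ : ∀ {x u y v} → Rational x u → Rational y v → 0ℤ ≤ x * y - R * (u * v)
    cross₁₁ {x} {u} {y} {v} (p , m) (q , n) = sq-cancel-≤ (*-nonneg p q)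
      (≡-nonneg (solve 5 (λ R x u y v →
          (x :* x :- R :* (u :* u)) :* (y :* y) :+ R :* (u :* u) :* (y :* y :- R :* (v :* v))
        := x :* y :* (x :* y) :- R :* (u :* v) :* (R :* (u :* v))) refl R x u y v)
        (+-nonneg (*-nonneg m (sq-nonneg y)) (*-nonneg (*-nonneg 0≤R (sq-nonneg u)) n)))

    cross₂₂ : ∀ {x u y v} → Irrational x u → Irrational y v → 0ℤ ≤ R * (- u * - v) - x * y
    cross₂₂ {x} {u} {y} {v} (p , m) (q , n) = sq-cancel-≤ (*-nonneg 0≤R (*-nonneg p q))
      (≡-nonneg (solve 5 (λ R x u y v →
          :- (x :* x :- R :* (u :* u)) :* (R :* (v :* v)) :+ x :* x :* :- (y :* y :- R :* (v :* v))
        := R :* (:- u :* :- v) :* (R :* (:- u :* :- v)) :- x :* y :* (x :* y)) refl R x u y v)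
        (+-nonneg (*-nonneg m (*-nonneg 0≤R (sq-nonneg v))) (*-nonneg (sq-nonneg x) n)))

    cross₁₂ : ∀ {x u y v} → Rational x u → Irrational y v → 0ℤ ≤ x * - v - u * y
    cross₁₂ {x} {u} {y} {v} (p , m) (q , n) = sq-cancel-≤ (*-nonneg p q) (*-pos-cancel 0<R
      (≡-nonneg (solve 5 (λ R x u y v →
          (x :* x :- R :* (u :* u)) :* (R :* (v :* v)) :+ R :* (u :* u) :* :- (y :* y :- R :* (v :* v))
        := R :* (x :* :- v :* (x :* :- v) :- u :* y :* (u :* y))) refl R x u y v)
        (+-nonneg (*-nonneg m (*-nonneg 0≤R (sq-nonneg v))) (*-nonneg (*-nonneg 0≤R (sq-nonneg u)) n))))

    -- Brahmagupta's identity; it settles the norm of a product, while the `cross` lemmas settle the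
    -- sign.
    norm-* : ∀ x u y v → norm x u * norm y v ≡ norm (x * y + R * (u * v)) (u * y + v * x)
    norm-* x u y v = solve 5 (λ R x u y v →
      (x :* x :- R :* (u :* u)) :* (y :* y :- R :* (v :* v)) :=
      (x :* y :+ R :* (u :* v)) :* (x :* y :+ R :* (u :* v)) :- R :* ((u :* y :+ v :* x) :* (u :* y :+ v :* x))) refl R x u y v

  0≤* : ∀ {x u y v} → Nonneg x u → Nonneg y v → Nonneg (x * y + R * (u * v)) (u * y + v * x)
  0≤* {x} {u} {y} {v} (inj₁ p) (inj₁ q) = inj₁
    ( ≡-nonneg (solve 5 (λ R x u y v → x :* y :- R :* (:- u :* v)
        := x :* y :+ R :* (u :* v)) refl R x u y v)
        (cross₁₁ (rational-conj p) q)
    , ≡-nonneg (norm-* x u y v) (*-nonneg (Rational.size p) (Rational.size q)))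
  0≤* {x} {u} {y} {v} (inj₁ p) (inj₂ q) = inj₂
    ( ≡-nonneg (solve 4 (λ x u y v → x :* :- v :- u :* y
        := :- (u :* y :+ v :* x)) refl x u y v) (cross₁₂ p q)
    , ≡-nonneg (trans (sym (neg-distribʳ-* (norm x u) (norm y v))) (cong -_ (norm-* x u y v)))
        (*-nonneg (Rational.size p) (Irrational.size q)))
  0≤* {x} {u} {y} {v} (inj₂ p) (inj₁ q) = inj₂
    ( ≡-nonneg (solve 4 (λ x u y v → y :* :- u :- v :* x
        := :- (u :* y :+ v :* x)) refl x u y v) (cross₁₂ q p)
    , ≡-nonneg (trans (sym (neg-distribˡ-* (norm x u) (norm y v))) (cong -_ (norm-* x u y v)))
        (*-nonneg (Irrational.size p) (Rational.size q)))
  0≤* {x} {u} {y} {v} (inj₂ p) (inj₂ q) = inj₁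
    ( ≡-nonneg (solve 5 (λ R x u y v → R :* (:- u :* :- v) :- :- x :* y
        := x :* y :+ R :* (u :* v)) refl R x u y v)
        (cross₂₂ (irrational-conj p) q)
    , ≡-nonneg (trans (solve 2 (λ a b → :- a :* :- b
        := a :* b) refl (norm x u) (norm y v)) (norm-* x u y v))
        (*-nonneg (Irrational.size p) (Irrational.size q)))

  private
    +-rational : ∀ {x u y v} → Rational x u → Rational y v → Rational (x + y) (u + v)
    +-rational {x} {u} {y} {v} p q = +-nonneg (Rational.sign p) (Rational.sign q) ,
      ≡-nonneg (solve 5 (λ R x u y v →
          x :* x :- R :* (u :* u) :+ (y :* y :- R :* (v :* v)) :+ # 2 :* (x :* y :- R :* (u :* v))
        := (x :+ y) :* (x :+ y) :- R :* ((u :+ v) :* (u :+ v))) refl R x u y v)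
        (+-nonneg (+-nonneg (Rational.size p) (Rational.size q)) (*-nonneg (0≤ 2) (cross₁₁ p q)))

    +-irrational : ∀ {x u y v} → Irrational x u → Irrational y v → Irrational (x + y) (u + v)
    +-irrational {x} {u} {y} {v} p q =
      ≡-nonneg (sym (ℤₚ.neg-distrib-+ u v)) (+-nonneg (Irrational.sign p) (Irrational.sign q)) ,
      ≡-nonneg (solve 5 (λ R x u y v →
          :- (x :* x :- R :* (u :* u)) :+ :- (y :* y :- R :* (v :* v)) :+ # 2 :* (R :* (:- u :* :- v) :- x :* y)
        := :- ((x :+ y) :* (x :+ y) :- R :* ((u :+ v) :* (u :+ v)))) refl R x u y v)
        (+-nonneg (+-nonneg (Irrational.size p) (Irrational.size q)) (*-nonneg (0≤ 2) (cross₂₂ p q)))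

    -- If the sum had the wrong sign, its negative could be added to one summand, giving a strict
    -- inequality for the negative of the other one.
    +-mixed : ∀ {x u y v} → Rational x u → Irrational y v → Nonneg (x + y) (u + v)
    +-mixed {x} {u} {y} {v} p q with 0ℤ ℤₚ.≤? x + y | 0ℤ ℤₚ.≤? - (u + v)
    ... | yes a | yes b = both-nonneg a b
    ... | yes a | no  b with 0ℤ ℤₚ.≤? norm (x + y) (u + v)
    ...   | yes c = inj₁ (a , c)
    ...   | no  c = ⊥-elim (no-cancellation
      (+-nonneg (+-nonneg (Rational.size p) (Irrational.size q)) (*-nonneg (0≤ 2) (cross₂₂ q neg-sum)))
      (ℤₚ.neg-mono-< (ℤₚ.≰⇒> c))
      (solve 5 (λ R x u y v →
          x :* x :- R :* (u :* u) :+ :- (y :* y :- R :* (v :* v))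
          :+ # 2 :* (R :* (:- v :* :- :- (u :+ v)) :- y :* :- (x :+ y))
          :+ :- ((x :+ y) :* (x :+ y) :- R :* ((u :+ v) :* (u :+ v)))
        := # 0) refl R x u y v))
      where
      neg-sum : Irrational (- (x + y)) (- (u + v))
      neg-sum = ℤₚ.<⇒≤ (ℤₚ.neg-mono-< (ℤₚ.≰⇒> b)) ,
        ≡-nonneg (cong -_ (norm-neg (x + y) (u + v))) (ℤₚ.<⇒≤ (ℤₚ.neg-mono-< (ℤₚ.≰⇒> c)))
    +-mixed {x} {u} {y} {v} p q | no a | yes b with 0ℤ ℤₚ.≤? - norm (x + y) (u + v)
    ...   | yes c = inj₂ (b , c)
    ...   | no  c = ⊥-elim (no-cancellation
      (+-nonneg (+-nonneg (Rational.size p) (Irrational.size q)) (*-nonneg (0≤ 2) (cross₁₁ p neg-sum)))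
      0<norm
      (solve 5 (λ R x u y v →
          x :* x :- R :* (u :* u) :+ :- (y :* y :- R :* (v :* v))
          :+ # 2 :* (x :* :- (x :+ y) :- R :* (u :* :- (u :+ v)))
          :+ ((x :+ y) :* (x :+ y) :- R :* ((u :+ v) :* (u :+ v)))
        := # 0) refl R x u y v))
      where
      0<norm : 0ℤ < norm (x + y) (u + v)
      0<norm = subst (0ℤ <_) (ℤₚ.neg-involutive _) (ℤₚ.neg-mono-< (ℤₚ.≰⇒> c))
      neg-sum : Rational (- (x + y)) (- (u + v))
      neg-sum = ℤₚ.<⇒≤ (ℤₚ.neg-mono-< (ℤₚ.≰⇒> a)) , ≡-nonneg (norm-neg (x + y) (u + v)) (ℤₚ.<⇒≤ 0<norm)
    -- With d = -(x + y) > 0 and s = u + v > 0, the difference N(x , u) - N(y , v) equals -2xd - d²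
    -- - R s (s - 2v), which is negative.
    +-mixed {x} {u} {y} {v} p q | no a | no b = ⊥-elim (no-cancellation
      (+-nonneg (+-nonneg (+-nonneg (Rational.size p) (Irrational.size q))
        (*-nonneg 0≤R (*-nonneg 0≤s (+-nonneg 0≤s (*-nonneg (0≤ 2) (Irrational.sign q))))))
        (*-nonneg (0≤ 2) (*-nonneg (Rational.sign p) (ℤₚ.<⇒≤ 0<d))))
      (*-pos 0<d 0<d)
      (solve 5 (λ R x u y v →
          x :* x :- R :* (u :* u) :+ :- (y :* y :- R :* (v :* v))
          :+ R :* (:- :- (u :+ v) :* (:- :- (u :+ v) :+ # 2 :* :- v))
          :+ # 2 :* (x :* :- (x :+ y)) :+ :- (x :+ y) :* :- (x :+ y)
        := # 0) refl R x u y v))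
      where
      0<d : 0ℤ < - (x + y)
      0<d = ℤₚ.neg-mono-< (ℤₚ.≰⇒> a)
      0≤s : 0ℤ ≤ - - (u + v)
      0≤s = ℤₚ.<⇒≤ (ℤₚ.neg-mono-< (ℤₚ.≰⇒> b))

  0≤+ : ∀ {x u y v} → Nonneg x u → Nonneg y v → Nonneg (x + y) (u + v)
  0≤+ (inj₁ p) (inj₁ q) = inj₁ (+-rational p q)
  0≤+ (inj₂ p) (inj₂ q) = inj₂ (+-irrational p q)
  0≤+ (inj₁ p) (inj₂ q) = +-mixed p q
  0≤+ {x} {u} {y} {v} (inj₂ p) (inj₁ q) = cast (ℤₚ.+-comm y x) (ℤₚ.+-comm v u) (+-mixed q p)

  *-cancel : ∀ {m x u} → 0ℤ < m → Nonneg (m * x) (m * u) → Nonneg x u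
  *-cancel {m} {x} {u} 0<m (inj₁ (p , n)) = inj₁ (*-pos-cancel 0<m p , *-pos-cancel 0<m (*-pos-cancel 0<m
    (≡-nonneg (solve 4 (λ R m x u → m :* x :* (m :* x) :- R :* (m :* u :* (m :* u))
        := m :* (m :* (x :* x :- R :* (u :* u)))) refl R m x u) n)))
  *-cancel {m} {x} {u} 0<m (inj₂ (p , n)) = inj₂
    ( *-pos-cancel 0<m (≡-nonneg (neg-distribʳ-* m u) p)
    , *-pos-cancel 0<m (*-pos-cancel 0<m
    (≡-nonneg (solve 4 (λ R m x u → :- (m :* x :* (m :* x) :- R :* (m :* u :* (m :* u)))
        := m :* (m :* :- (x :* x :- R :* (u :* u)))) refl R m x u) n)))

  ι : ∀ {x} → 0ℤ ≤ x → Nonneg x 0ℤ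
  ι p = both-nonneg p (+≤+ ℕ.z≤n)

  ι⁻¹ : ∀ {x} → Nonneg x 0ℤ → 0ℤ ≤ x
  ι⁻¹ (inj₁ (p , _)) = p
  -- Here -x² ≥ 0; comparing the squares of -x and 0 gives -x ≤ 0.
  ι⁻¹ {x} (inj₂ (_ , n)) = ≡-nonneg (trans (ℤₚ.+-identityˡ _) (ℤₚ.neg-involutive x))
    (sq-cancel-≤ {p = - x} ℤₚ.≤-refl (≡-nonneg (solve 2 (λ R x → :- (x :* x :- R :* (# 0 :* # 0))
        := # 0 :* # 0 :- :- x :* :- x) refl R x) n))

  scale : ∀ {m x u} → 0ℤ ≤ m → Nonneg x u → Nonneg (m * x) (m * u)
  scale {m} {x} {u} 0≤m p = cast
    (solve 4 (λ R m x u → m :* x :+ R :* (# 0 :* u) := m :* x) refl R m x u)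
    (solve 3 (λ m x u → # 0 :* x :+ u :* m := m :* u) refl m x u)
    (0≤* (ι 0≤m) p)

  nonneg? : ∀ x u → Dec (Nonneg x u)
  nonneg? x u =
    map′ (λ (p , q) → p , q) (λ (p , q) → p , q) (0ℤ ℤₚ.≤? x ×-dec 0ℤ ℤₚ.≤? norm x u) ⊎-dec
    map′ (λ (p , q) → p , q) (λ (p , q) → p , q) (0ℤ ℤₚ.≤? - u ×-dec 0ℤ ℤₚ.≤? - norm x u)

  monoˡ : ∀ {x y u} → x ≤ y → Nonneg x u → Nonneg y u
  monoˡ {x} {y} {u} x≤y p = cast (solve 2 (λ x y → x :+ (y :- x) := y) refl x y) (ℤₚ.+-identityʳ u)
    (0≤+ p (ι (ℤₚ.i≤j⇒0≤j-i x≤y)))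

  monoʳ : ∀ {x u v} → v ≤ u → Nonneg x u → Nonneg x v
  monoʳ {x} {u} {v} v≤u p = cast (ℤₚ.+-identityʳ x) (solve 2 (λ u v → u :+ (v :- u) := v) refl u v)
    (0≤+ p (both-nonneg ℤₚ.≤-refl (≡-nonneg (solve 2 (λ u v → u :- v
        := :- (v :- u)) refl u v) (ℤₚ.i≤j⇒0≤j-i v≤u))))

  neg-nonneg : ∀ {x u} → ¬ Nonneg x u → Nonneg (- x) (- u)
  neg-nonneg {x} {u} ¬p with total x u
  ... | inj₁ p = contradiction p ¬p
  ... | inj₂ p = p

  -- The hypotheses say x = u√R. The conclusion is a vanishing norm, not vanishing coordinates,
  -- because R may be a square.
  antisym : ∀ {x u} → Nonneg x u → Nonneg (- x) (- u) → norm x u ≡ 0ℤ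
  antisym {x} {u} p q = ℤₚ.≤-antisym (ℤₚ.0≤i-j⇒j≤i (≡-nonneg (sym (ℤₚ.+-identityˡ (- norm x u))) (norm≤0 p q))) (0≤norm p q)
    where
    0≤norm : Nonneg x u → Nonneg (- x) (- u) → 0ℤ ≤ norm x u
    0≤norm (inj₁ (_ , p)) _ = p
    0≤norm (inj₂ _) (inj₁ (_ , q)) = ≡-nonneg (sym (norm-neg x u)) q
    0≤norm (inj₂ (p , _)) (inj₂ (q , _)) = ≡-nonneg
      (solve 3 (λ R x u → x :* x :+ R :* (:- u :* :- :- u) := x :* x :- R :* (u :* u)) refl R x u)
      (+-nonneg (sq-nonneg x) (*-nonneg 0≤R (*-nonneg p q)))
    norm≤0 : Nonneg x u → Nonneg (- x) (- u) → 0ℤ ≤ - norm x u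
    norm≤0 (inj₂ (_ , p)) _ = p
    norm≤0 (inj₁ _) (inj₂ (_ , q)) = ≡-nonneg (cong -_ (sym (norm-neg x u))) q
    norm≤0 (inj₁ (p , _)) (inj₁ (q , _)) = ≡-nonneg
      (solve 3 (λ R x u → R :* (u :* u) :+ x :* :- x := :- (x :* x :- R :* (u :* u))) refl R x u)
      (+-nonneg (*-nonneg 0≤R (sq-nonneg u)) (*-nonneg p q))

-- Elements of ℤ[√R] as pairs of solver polynomials

module _ {n : ℕ} where
  infixl 6 _⊕_
  infixl 7 _⊙_
  _⊕_ : Polynomial n × Polynomial n → Polynomial n × Polynomial n → Polynomial n × Polynomial n
  (x , u) ⊕ (y , v) = x :+ y , u :+ v

  _⊙_ : Polynomial n → Polynomial n × Polynomial n → Polynomial n × Polynomial n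
  m ⊙ (x , u) = m :* x , m :* u

  product : Polynomial n → Polynomial n × Polynomial n → Polynomial n × Polynomial n → Polynomial n × Polynomial n
  product R (x , u) (y , v) = x :* y :+ R :* (u :* v) , u :* y :+ v :* x

  -- Syntactic counterparts of the elements that `f`, `g`, `θ`, `Telescoped` and `key` assert to be
  -- nonnegative, so that the coordinates of a weighted sum of products are computed instead of
  -- written out.
  fᵖ gᵖ : Polynomial n → Polynomial n × Polynomial n
  fᵖ s = :- (# 2 :* s) , con -1ℤ
  gᵖ s = # 2 :* s :+ # 2 , # 1

  θᵖ : (r k c : Polynomial n) → Polynomial n × Polynomial n
  θᵖ r k c = # 2 :* c :+ r , k

  telescopedᵖ : (r s k j Σc c₁ cⱼ : Polynomial n) → Polynomial n × Polynomial n
  telescopedᵖ r s k j Σc c₁ cⱼ =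
    # 4 :* Σc :+ # 2 :* (j :* r) :+ # 4 :* s :* (j :* (s :+ # 1) :- (cⱼ :- c₁)) ,
    # 2 :* (j :* k) :+ j :* (j :+ # 1) :+ # 2 :* (j :* (s :+ # 1) :- (cⱼ :- c₁))

  keyᵖ : (r s k c₀ cₛ Σc : Polynomial n) → Polynomial n × Polynomial n
  keyᵖ r s k c₀ cₛ Σc = # 2 :* (Σc :+ cₛ :- s :* (c₀ :+ r) :- r :* k) :- r , :- (c₀ :+ r)

-- Excesses of consecutive ceilings

module Ceilings (r s : ℤ) (2≤r : 0ℤ ≤ r - + 2) (1≤s : 0ℤ ≤ s - 1ℤ)
  (s²≤r : 0ℤ ≤ r - s * s) (r≤s²+2s : 0ℤ ≤ s * s + + 2 * s - r) where

  0≤s : 0ℤ ≤ s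
  0≤s = ≡-nonneg (solve 1 (λ s → s :- # 1 :+ # 1 := s) refl s) (+-nonneg 1≤s (+≤+ ℕ.z≤n))

  0<4r : 0ℤ < + 4 * r
  0<4r = *-pos {+ 4} (+<+ (ℕ.s≤s ℕ.z≤n)) (ℤₚ.<-≤-trans (+<+ (ℕ.s≤s ℕ.z≤n)) (ℤₚ.0≤i-j⇒j≤i 2≤r))

  open QuadraticOrder (+ 4 * r) 0<4r

  -- With φ = √r - s the fractional part of √r, f says 0 ≤ 2φ, g says 0 ≤ 2(1 - φ), and θ k c says
  -- 0 ≤ 2(c - k√r + r/2).
  f : Nonneg (- (+ 2 * s)) -1ℤ
  f = inj₂ (+≤+ ℕ.z≤n , ≡-nonneg
      (solve 2 (λ r s → # 4 :* (r :- s :* s)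
          := :- (:- (# 2 :* s) :* :- (# 2 :* s) :- # 4 :* r :* (con -1ℤ :* con -1ℤ))) refl r s)
      (*-nonneg (0≤ 4) s²≤r))

  g : Nonneg (+ 2 * s + + 2) 1ℤ
  g = inj₁ (+-nonneg (*-nonneg (0≤ 2) 0≤s) (+≤+ ℕ.z≤n) , ≡-nonneg
      (solve 2 (λ r s → # 4 :* (s :* s :+ # 2 :* s :- r) :+ # 4
         := (# 2 :* s :+ # 2) :* (# 2 :* s :+ # 2) :- # 4 :* r :* (# 1 :* # 1)) refl r s)
      (+-nonneg (*-nonneg (0≤ 4) r≤s²+2s) (+≤+ ℕ.z≤n)))

  θ : ℤ → ℤ → Set
  θ k c = Nonneg (+ 2 * c + r) k

  -- θ ≥ φ (s + 1 - D) for the excess θ at k and D = c₁ - c₀: clear if D > s, and otherwise θ exceeds the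
  -- next excess by √r - D = φ + (s - D).
  step : ∀ {k c₀ c₁} → θ k c₀ → θ (k + 1ℤ) c₁ →
      Nonneg (+ 2 * c₀ + r + + 2 * s * (s + 1ℤ - (c₁ - c₀))) (k + (s + 1ℤ - (c₁ - c₀)))
  step {k} {c₀} {c₁} θ₀ θ₁ with 0≤-dec (c₁ - c₀ - s - 1ℤ)
  ... | inj₁ D>s = cast
      (solve 4 (λ r s c₀ c₁ → # 2 :* c₀ :+ r :+ (c₁ :- c₀ :- s :- # 1) :* :- (# 2 :* s)
        := # 2 :* c₀ :+ r :+ # 2 :* s :* (s :+ # 1 :- (c₁ :- c₀))) refl r s c₀ c₁)
      (solve 4 (λ s k c₀ c₁ → k :+ (c₁ :- c₀ :- s :- # 1) :* con -1ℤ
          := k :+ (s :+ # 1 :- (c₁ :- c₀))) refl s k c₀ c₁)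
      (0≤+ θ₀ (scale D>s f))
  ... | inj₂ D≤s = cast
      (solve 4 (λ r s c₀ c₁ → # 2 :* c₁ :+ r :+ (con -1ℤ :- (c₁ :- c₀ :- s :- # 1)) :* (# 2 :* s :+ # 2)
        := # 2 :* c₀ :+ r :+ # 2 :* s :* (s :+ # 1 :- (c₁ :- c₀))) refl r s c₀ c₁)
      (solve 4 (λ s k c₀ c₁ → k :+ # 1 :+ (con -1ℤ :- (c₁ :- c₀ :- s :- # 1)) :* # 1
          := k :+ (s :+ # 1 :- (c₁ :- c₀))) refl s k c₀ c₁)
      (0≤+ θ₁ (scale D≤s g))

  -- Twice the sum of step over k + 1, …, k + j, where the differences of c telescope; Σc is the sum of c
  -- over these indices. A record, so that conversion checking compares the indices and not the formulas.
  record Telescoped (k j Σc c₁ cⱼ : ℤ) : Set where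
    constructor telescoped
    field
      nonneg : Nonneg (+ 4 * Σc + + 2 * (j * r) + + 4 * s * (j * (s + 1ℤ) - (cⱼ - c₁)))
                      (+ 2 * (j * k) + j * (j + 1ℤ) + + 2 * (j * (s + 1ℤ) - (cⱼ - c₁)))

  telescoped-zero : ∀ k c₁ → Telescoped k 0ℤ 0ℤ c₁ c₁
  telescoped-zero k c₁ = telescoped (cast
      (solve 3 (λ r s c₁ → # 0
          := # 4 :* # 0 :+ # 2 :* (# 0 :* r) :+ # 4 :* s :* (# 0 :* (s :+ # 1) :- (c₁ :- c₁))) refl r s c₁)
      (solve 3 (λ k s c₁ → # 0
          := # 2 :* (# 0 :* k) :+ # 0 :* (# 0 :+ # 1) :+ # 2 :* (# 0 :* (s :+ # 1) :- (c₁ :- c₁)))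
          refl k s c₁)
      (ι ℤₚ.≤-refl))

  telescoped-suc : ∀ {k j Σc c₁ c₂ c₃} → Telescoped k j Σc c₁ c₂ → θ (k + (1ℤ + j)) c₂ → θ (k + (1ℤ + j) + 1ℤ) c₃ →
    Telescoped k (1ℤ + j) (Σc + c₂) c₁ c₃
  telescoped-suc {k} {j} {Σc} {c₁} {cⱼ} {cⱼ₊₁} (telescoped t) θ₂ θ₃ = telescoped (cast
      (solve 7 (λ r s j Σc c₁ cⱼ cⱼ₊₁ →
        # 4 :* Σc :+ # 2 :* (j :* r) :+ # 4 :* s :* (j :* (s :+ # 1) :- (cⱼ :- c₁))
          :+ # 2 :* (# 2 :* cⱼ :+ r :+ # 2 :* s :* (s :+ # 1 :- (cⱼ₊₁ :- cⱼ)))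
       
            := # 4 :* (Σc :+ cⱼ) :+ # 2 :* ((# 1 :+ j) :* r) :+ # 4 :* s :* ((# 1 :+ j) :* (s :+ # 1) :- (cⱼ₊₁ :- c₁)))
        refl r s j Σc c₁ cⱼ cⱼ₊₁)
      (solve 6 (λ s k j c₁ cⱼ cⱼ₊₁ →
        # 2 :* (j :* k) :+ j :* (j :+ # 1) :+ # 2 :* (j :* (s :+ # 1) :- (cⱼ :- c₁))
          :+ # 2 :* (k :+ (# 1 :+ j) :+ (s :+ # 1 :- (cⱼ₊₁ :- cⱼ)))
       
            := # 2 :* ((# 1 :+ j) :* k) :+ (# 1 :+ j) :* ((# 1 :+ j) :+ # 1) :+ # 2 :* ((# 1 :+ j) :* (s :+ # 1) :- (cⱼ₊₁ :- c₁)))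
        refl s k j c₁ cⱼ cⱼ₊₁)
      (0≤+ t (scale (0≤ 2) (step θ₂ θ₃))))

  -- 4 (φ² + 2φ - 1 + (s - 1)(1 - φ)), which for s = 1 equals 4 (r - 2): here 2 ≤ r is needed.
  bracket : Nonneg (+ 4 * r + + 8 * (s * s) - + 8 * s - + 8) (+ 6 * s - + 6)
  bracket with 0≤-dec (s - + 2)
  ... | inj₁ 2≤s = cast
    (solve 2 (λ r s → proj₁ (poly r s) := # 4 :* r :+ # 8 :* (s :* s) :- # 8 :* s :- # 8) refl r s)
    (solve 2 (λ r s → proj₂ (poly r s) := # 6 :* s :- # 6) refl r s)
    (0≤+ (0≤+ (0≤* f f) (scale (0≤ 2) f)) (scale (0≤ 2) (scale 2≤s g)))
    where
    poly : ∀ {n} → Polynomial n → Polynomial n → Polynomial n × Polynomial n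
    poly r s = product (# 4 :* r) (fᵖ s) (fᵖ s) ⊕ # 2 ⊙ fᵖ s ⊕ # 2 ⊙ ((s :- # 2) ⊙ gᵖ s)
  ... | inj₂ s≤1 = cast
    (trans (solve 1 (λ r → # 4 :* (r :- # 2)
        := # 4 :* r :+ # 8 :* (# 1 :* # 1) :- # 8 :* # 1 :- # 8) refl r)
      (cong (λ s → + 4 * r + + 8 * (s * s) - + 8 * s - + 8) 1≡s))
    (trans (solve 1 (λ r → # 4 :* # 0 := # 6 :* # 1 :- # 6) refl r) (cong (λ s → + 6 * s - + 6) 1≡s))
    (scale (0≤ 4) (ι 2≤r))
    where
    1≡s : 1ℤ ≡ s
    1≡s = ℤₚ.≤-antisym (ℤₚ.0≤i-j⇒j≤i 1≤s)
      (ℤₚ.0≤i-j⇒j≤i (≡-nonneg (solve 1 (λ s → con -1ℤ :- (s :- # 2) := # 1 :- s) refl s) s≤1))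

  -- Twice the inequality φ θ₀ + θ₁ + … + θₛ ≥ √r φ (1 - φ) / 2 for consecutive excesses. The telescoped sum
  -- reduces it to a lower bound for θ₀ + θ₁, which is at least 1 - φ if c₁ - c₀ > s and at least φ otherwise.
  key : ∀ {k c₀ c₁ cₛ Σc} → θ k c₀ → θ (k + 1ℤ) c₁ → θ (k + s) cₛ → Telescoped k (s - 1ℤ) Σc c₁ cₛ →
    Nonneg (+ 2 * (Σc + cₛ - s * (c₀ + r) - r * k) - r) (- (c₀ + r))
  key {k} {c₀} {c₁} {cₛ} {Σc} θ₀ θ₁ θₛ (telescoped t) with 0≤-dec (c₁ - c₀ - s - 1ℤ)
  ... | inj₁ D>s = *-cancel {+ 8} (+<+ (ℕ.s≤s ℕ.z≤n)) (cast
    (solve 7 (λ r s k c₀ c₁ cₛ Σc → proj₁ (lhs r s k c₀ c₁ cₛ Σc)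
        := proj₁ (# 8 ⊙ keyᵖ r s k c₀ cₛ Σc)) refl r s k c₀ c₁ cₛ Σc)
    (solve 7 (λ r s k c₀ c₁ cₛ Σc → proj₂ (lhs r s k c₀ c₁ cₛ Σc)
        := proj₂ (# 8 ⊙ keyᵖ r s k c₀ cₛ Σc)) refl r s k c₀ c₁ cₛ Σc)
    -- After division by 16, and with cₛ - c₁ = θₛ - θ₁ + (s - 1)√r, the first two terms give θ₁ +
    -- ... + θₛ - φθ₁ - (s - 1)φ(1 - φ). The third gives φ(θ₀ + θ₁) - φ(1 - φ), as D - √r = θ₁ - θ₀.
    -- The last makes up the difference to -√r φ(1 - φ)/2.
    (0≤+ (0≤+ (0≤+ (scale (0≤ 4) t) (scale (0≤ 4) (0≤* g θₛ)))
         (scale (0≤ 8) (0≤* f (0≤+ θ₀ (ι D>s)))))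
         (0≤* (0≤* f g) (0≤+ (ι (*-nonneg (0≤ 2) 1≤s)) g))))
    where
    lhs : ∀ {n} (r s k c₀ c₁ cₛ Σc : Polynomial n) → Polynomial n × Polynomial n
    lhs r s k c₀ c₁ cₛ Σc = # 4 ⊙ telescopedᵖ r s k (s :- # 1) Σc c₁ cₛ ⊕ # 4 ⊙ mul (gᵖ s) (θᵖ r (k :+ s) cₛ)
      ⊕ # 8 ⊙ mul (fᵖ s) (θᵖ r k c₀ ⊕ (c₁ :- c₀ :- s :- # 1 , # 0))
      ⊕ mul (mul (fᵖ s) (gᵖ s)) ((# 2 :* (s :- # 1) , # 0) ⊕ gᵖ s)
      where mul = product (# 4 :* r)
  ... | inj₂ D≤s = *-cancel {+ 8} (+<+ (ℕ.s≤s ℕ.z≤n)) (cast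
    (solve 7 (λ r s k c₀ c₁ cₛ Σc → proj₁ (lhs r s k c₀ c₁ cₛ Σc)
        := proj₁ (# 8 ⊙ keyᵖ r s k c₀ cₛ Σc)) refl r s k c₀ c₁ cₛ Σc)
    (solve 7 (λ r s k c₀ c₁ cₛ Σc → proj₂ (lhs r s k c₀ c₁ cₛ Σc)
        := proj₂ (# 8 ⊙ keyᵖ r s k c₀ cₛ Σc)) refl r s k c₀ c₁ cₛ Σc)
    -- The third term now gives φ(2θ₁ + s - D) = φ(θ₀ + θ₁) - φ²; what is still missing is the
    -- multiple of φ supplied by `bracket`.
    (0≤+ (0≤+ (0≤+ (scale (0≤ 4) t) (scale (0≤ 4) (0≤* g θₛ)))
         (scale (0≤ 8) (0≤* f (0≤+ θ₁ (ι D≤s)))))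
         (0≤* f bracket)))
    where
    lhs : ∀ {n} (r s k c₀ c₁ cₛ Σc : Polynomial n) → Polynomial n × Polynomial n
    lhs r s k c₀ c₁ cₛ Σc = # 4 ⊙ telescopedᵖ r s k (s :- # 1) Σc c₁ cₛ ⊕ # 4 ⊙ mul (gᵖ s) (θᵖ r (k :+ s) cₛ)
      ⊕ # 8 ⊙ mul (fᵖ s) (θᵖ r (k :+ # 1) c₁ ⊕ (con -1ℤ :- (c₁ :- c₀ :- s :- # 1) , # 0))
      ⊕ mul (fᵖ s) (# 4 :* r :+ # 8 :* (s :* s) :- # 8 :* s :- # 8 , # 6 :* s :- # 6)
      where mul = product (# 4 :* r)

-- Decomposition into blocks and the upper bound

intervalSum : (ℤ → ℤ) → ℤ → ℕ → ℤ
intervalSum a m zero    = 0ℤ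
intervalSum a m (suc l) = intervalSum a m l + a (m + + l)

module Upper (r s′ : ℕ) (2≤r : 0ℤ ≤ + r - + 2)
  (s²≤r : 0ℤ ≤ + r - + suc s′ * + suc s′) (r≤s²+2s : 0ℤ ≤ + suc s′ * + suc s′ + + 2 * + suc s′ - + r) where

  private
    s : ℤ
    s = + suc s′

  1≤s : 0ℤ ≤ s - 1ℤ
  1≤s = +≤+ ℕ.z≤n

  open Ceilings (+ r) s 2≤r 1≤s s²≤r r≤s²+2s public
  open QuadraticOrder (+ 4 * + r) 0<4r

  0≤r : 0ℤ ≤ + r
  0≤r = +≤+ ℕ.z≤n

  √4r≤2r : Nonneg (+ 2 * + r) 1ℤ
  √4r≤2r = inj₁ (*-nonneg (0≤ 2) 0≤r ,
    ≡-nonneg (solve 1 (λ r → # 4 :* (r :* (r :- # 2 :+ # 1))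
        := # 2 :* r :* (# 2 :* r) :- # 4 :* r :* (# 1 :* # 1)) refl (+ r))
      (*-nonneg (0≤ 4) (*-nonneg 0≤r (+-nonneg 2≤r (+≤+ ℕ.z≤n)))))

  -- A crude estimate that confines the search for a ceiling to a finite range.
  √4r≤2r∣_∣ : ∀ u → Nonneg (+ ∣ u ∣ * (+ 2 * + r)) u
  √4r≤2r∣ + n ∣ = cast refl (solve 1 (λ n → n :* # 1 := n) refl (+ n)) (scale (0≤ n) √4r≤2r)
  √4r≤2r∣ -[1+ n ] ∣ = both-nonneg (*-nonneg (0≤ suc n) (*-nonneg (0≤ 2) 0≤r)) (+≤+ ℕ.z≤n)

  θ-mono : ∀ {k x y} → x ≤ y → θ k x → θ k y
  θ-mono x≤y = monoˡ (ℤₚ.+-monoˡ-≤ (+ r) (2*-mono x≤y))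

  record Ceiling (k c : ℤ) : Set where
    field
      above   : θ k c
      minimal : ¬ θ k (c - 1ℤ)

    least : ∀ {x} → θ k x → c ≤ x
    least {x} p with c ℤₚ.≤? x
    ... | yes c≤x = c≤x
    ... | no  c≰x = contradiction (θ-mono (<-pred (ℤₚ.≰⇒> c≰x)) p) minimal

  -- The search descends from the upper end; since `θ` is monotone in its second argument, the first
  -- failure lies just below the ceiling.
  search : ∀ {k} l lo → ¬ θ k lo → θ k (lo + + l) → Σ ℤ (Ceiling k)
  search {k} zero lo ¬p p = contradiction (subst (θ k) (ℤₚ.+-identityʳ lo) p) ¬p
  search {k} (suc l) lo ¬p p with nonneg? (+ 2 * (lo + + l) + + r) k
  ... | yes q = search l lo ¬p q
  ... | no ¬q = lo + + suc l , record
    { above = p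
    ; minimal = λ q → ¬q (subst (θ k) (trans (cong (λ y → y - 1ℤ) (+-suc-assoc lo l))
        (solve 2 (λ lo l → lo :+ l :+ # 1 :- # 1 := lo :+ l) refl lo (+ l))) q) }

  -- Opaque, as otherwise the search is unfolded during conversion checking.
  opaque
    ceiling : ∀ k → Σ ℤ (Ceiling k)
    ceiling k = search ∣ width ∣ lo ¬below (subst (θ k) (sym lo+width) above)
      where
      K lo width : ℤ
      K = + ∣ k ∣ * + r
      -- At `K` the term |k|r outweighs k√r; at `lo` the excess is at most -r/2.
      lo = - K - + r
      width = K + K + + r
      above : θ k K
      above = cast (solve 2 (λ n r → n :* (# 2 :* r) :+ r := # 2 :* (n :* r) :+ r) refl (+ ∣ k ∣) (+ r))
        (ℤₚ.+-identityʳ k) (0≤+ √4r≤2r∣ k ∣ (ι 0≤r))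
      lo+width : lo + + ∣ width ∣ ≡ K
      lo+width = trans (cong (λ y → lo + y) (ℤₚ.0≤i⇒+∣i∣≡i (+-nonneg (+-nonneg 0≤K 0≤K) 0≤r)))
        (solve 2 (λ K r → :- K :- r :+ (K :+ K :+ r) := K) refl K (+ r))
        where
        0≤K : 0ℤ ≤ K
        0≤K = *-nonneg (0≤ ∣ k ∣) 0≤r
      ¬below : ¬ θ k lo
      ¬below p = no-cancellation (ι⁻¹ (cast
          (trans (cong (λ n → + 2 * lo + + r + + n * (+ 2 * + r)) (ℤₚ.∣-i∣≡∣i∣ k))
            (solve 2 (λ n r → # 2 :* (:- (n :* r) :- r) :+ r :+ n :* (# 2 :* r)
                := :- r) refl (+ ∣ k ∣) (+ r)))
          (ℤₚ.+-inverseʳ k) (0≤+ p √4r≤2r∣ - k ∣)))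
        (ℤₚ.<-≤-trans (+<+ (ℕ.s≤s ℕ.z≤n)) (ℤₚ.0≤i-j⇒j≤i 2≤r)) (ℤₚ.+-inverseˡ (+ r))

  c : ℤ → ℤ
  c k = proj₁ (ceiling k)

  module C (k : ℤ) = Ceiling (proj₂ (ceiling k))

  -- Since √r ≥ 1, lowering c(k + 1) by 1 still leaves a nonnegative excess at k.
  c-increasing : ∀ k → c k + 1ℤ ≤ c (k + 1ℤ)
  c-increasing k = subst (λ y → c k + 1ℤ ≤ y) (solve 1 (λ x → x :- # 1 :+ # 1 := x) refl (c (k + 1ℤ)))
    (ℤₚ.+-monoˡ-≤ 1ℤ (C.least k (cast
      (solve 3 (λ c r s → # 2 :* c :+ r :+ (:- (# 2 :* s) :+ # 2 :* (s :- # 1))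
          := # 2 :* (c :- # 1) :+ r) refl (c (k + 1ℤ)) (+ r) s)
      (solve 1 (λ k → k :+ # 1 :+ (con -1ℤ :+ # 0) := k) refl k)
      (0≤+ (C.above (k + 1ℤ)) (0≤+ f (ι (*-nonneg (0≤ 2) 1≤s)))))))

  csum : ℤ → ℕ → ℤ
  csum k zero    = 0ℤ
  csum k (suc j) = csum k j + c (k + + suc j)

  csum-shift : ∀ k j → csum k (suc j) ≡ c (k + 1ℤ) + csum (k + 1ℤ) j
  csum-shift k zero    = ℤₚ.+-comm 0ℤ (c (k + 1ℤ))
  csum-shift k (suc j) = trans (cong₂ _+_ (csum-shift k j)
      (cong c (solve 2 (λ k j → k :+ (# 2 :+ j) := k :+ # 1 :+ (# 1 :+ j)) refl k (+ j))))
    (ℤₚ.+-assoc (c (k + 1ℤ)) (csum (k + 1ℤ) j) (c (k + 1ℤ + + suc j)))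

  telescoping : ∀ k j → Telescoped k (+ j) (csum k j) (c (k + 1ℤ)) (c (k + + suc j))
  telescoping k zero    = telescoped-zero k (c (k + 1ℤ))
  telescoping k (suc j) = telescoped-suc (telescoping k j) (C.above (k + + suc j))
    (subst (λ k′ → θ k′ (c (k + + suc (suc j)))) (+-suc-assoc k (suc j)) (C.above (k + + suc (suc j))))

  key-at : ∀ k → Nonneg (+ 2 * (csum k (suc s′) - s * (c k + + r) - + r * k) - + r) (- (c k + + r))
  key-at k = key (C.above k) (C.above (k + 1ℤ)) (C.above (k + s)) (telescoping k s′)

  module _ (a : ℤ → ℤ) (floor-above : ∀ n → θ (a n) n) (floor-maximal : ∀ n → ¬ θ (a n + 1ℤ) n) where

    -- One half of the adjunction between `c` and `a`: if k ≤ a(x), then the excess of x at k is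
    -- nonnegative, so x is not below c(k).
    a-below : ∀ {x k} → x < c k → a x < k
    a-below {x} {k} x<c with a x ℤₚ.<? k
    ... | yes p = p
    ... | no ¬p = contradiction (θ-mono (<-pred x<c) (monoʳ (ℤₚ.≮⇒≥ ¬p) (floor-above x))) (C.minimal k)

    -- For j = 0 there is no condition, because with k = a m the block of index 0 already contains
    -- m.
    Above : ℤ → ℕ → ℤ → Set
    Above k zero    x = ⊤
    Above k (suc j) x = c (k + + suc j) ≤ x

    -- a ≤ a m + i on the i-th block [c(a m + i) , c(a m + i + 1)); summation by parts.
    block-bound : ∀ m j l → let k = a m in Above k j (m + + l) → m + + l ≤ c (k + + suc j) →
      0ℤ ≤ (m + + l) * (k + + j) - m * k - csum k j - intervalSum a m l
    block-bound m zero zero _ _ = ℤₚ.≤-reflexive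
      (solve 2 (λ m k → # 0 := (m :+ # 0) :* (k :+ # 0) :- m :* k :- # 0 :- # 0) refl m (a m))
    -- A later block starting at or before m would contradict the maximality of a m.
    block-bound m (suc j) zero cⱼ≤m _ = contradiction
      (monoʳ (ℤₚ.+-monoʳ-≤ (a m) (+≤+ (ℕ.s≤s ℕ.z≤n)))
        (θ-mono (subst (c (a m + + suc j) ≤_) (ℤₚ.+-identityʳ m) cⱼ≤m) (C.above (a m + + suc j))))
      (floor-maximal m)
    block-bound m zero (suc l) _ x<c = ≡-nonneg
      (solve 5 (λ m l k T aₓ → (m :+ l) :* (k :+ # 0) :- m :* k :- # 0 :- T :+ (k :+ # 1 :- # 1 :- aₓ)
        
             := (m :+ (# 1 :+ l)) :* (k :+ # 0) :- m :* k :- # 0 :- (T :+ aₓ))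
             refl m (+ l) (a m) (intervalSum a m l) (a (m + + l)))
      (+-nonneg (block-bound m zero l tt (ℤₚ.<⇒≤ x<c′)) (ℤₚ.i≤j⇒0≤j-i (<-pred (a-below x<c′))))
      where
      x<c′ : m + + l < c (a m + 1ℤ)
      x<c′ = suc-≤⇒< (subst (_≤ c (a m + 1ℤ)) (+-suc-assoc m l) x<c)
    block-bound m (suc j) (suc l) cⱼ≤x+1 x<c with c (a m + + suc j) ℤₚ.≤? m + + l
    ... | yes cⱼ≤x = ≡-nonneg
      (solve 7 (λ m l j k Σc T aₓ → (m :+ l) :* (k :+ (# 1 :+ j)) :- m :* k :- Σc :- T :+ (k :+ (# 2 :+ j) :- # 1 :- aₓ)
        
             := (m :+ (# 1 :+ l)) :* (k :+ (# 1 :+ j)) :- m :* k :- Σc :- (T :+ aₓ))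
             refl m (+ l) (+ j) (a m) (csum (a m) (suc j)) (intervalSum a m l) (a (m + + l)))
      (+-nonneg (block-bound m (suc j) l cⱼ≤x (ℤₚ.<⇒≤ x<c′)) (ℤₚ.i≤j⇒0≤j-i (<-pred (a-below x<c′))))
      where
      x<c′ : m + + l < c (a m + + suc (suc j))
      x<c′ = suc-≤⇒< (subst (_≤ c (a m + + suc (suc j))) (+-suc-assoc m l) x<c)
    -- The last block is still empty: its start is exactly the right end of the interval, so it
    -- contributes nothing and the recursion drops it.
    ... | no cⱼ≰x = ≡-nonneg
      (trans (solve 7 (λ m l j k Σc T aₓ → (m :+ l) :* (k :+ j) :- m :* k :- Σc :- T :+ (k :+ (# 1 :+ j) :- # 1 :- aₓ)
        
             := (m :+ (# 1 :+ l)) :* (k :+ (# 1 :+ j)) :- m :* k :- (Σc :+ (m :+ (# 1 :+ l))) :- (T :+ aₓ))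
             refl m (+ l) (+ j) (a m) (csum (a m) j) (intervalSum a m l) (a (m + + l)))
        (cong (λ y → (m + + suc l) * (a m + + suc j) - m * a m - (csum (a m) j + y) - intervalSum a m (suc l)) (sym cⱼ≡x+1)))
      (+-nonneg (block-bound m j l (previous j x<cⱼ cⱼ≡x+1) (ℤₚ.<⇒≤ x<cⱼ)) (ℤₚ.i≤j⇒0≤j-i (<-pred (a-below x<cⱼ))))
      where
      x<cⱼ : m + + l < c (a m + + suc j)
      x<cⱼ = ℤₚ.≰⇒> cⱼ≰x
      cⱼ≡x+1 : c (a m + + suc j) ≡ m + + suc l
      cⱼ≡x+1 = ℤₚ.≤-antisym cⱼ≤x+1 (subst (_≤ c (a m + + suc j)) (sym (+-suc-assoc m l)) (<-suc x<cⱼ))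
      previous : ∀ j → m + + l < c (a m + + suc j) → c (a m + + suc j) ≡ m + + suc l → Above (a m) j (m + + l)
      previous zero    _ _  = tt
      -- Block starts increase strictly, so the preceding one is at most m + l.
      previous (suc j) _ eq = ℤₚ.≤-trans (<-pred (ℤₚ.<-≤-trans (suc-≤⇒< (c-increasing (a m + + suc j)))
          (ℤₚ.≤-reflexive (trans (cong c (sym (+-suc-assoc (a m) (suc j)))) eq))))
        (ℤₚ.≤-reflexive (solve 2 (λ m l → m :+ (# 1 :+ l) :- # 1 := m :+ l) refl m (+ l)))

    -- For m = n + 1 - r this is S n + r/2 ≤ (n + 1)√r. If N ≤ c(k + s + 1), the blocks k, ..., k +
    -- s suffice: `key` at k applies, and moving from c(k) to m costs a multiple of φ. Otherwise one
    -- more block occurs: `key` at k + 1 applies, and moving from c(k + 1) back to m costs a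
    -- multiple of 1 - φ.
    upper-bound : ∀ m → Nonneg (- (+ 2 * intervalSum a m r + + r)) (- (m + + r))
    upper-bound m = bound (N ℤₚ.≤? c (k + + suc (suc s′)))
      where
      k N : ℤ
      k = a m
      N = m + + r
      T : ℤ
      T = intervalSum a m r

      cₛ≤N : c (k + s) ≤ N
      cₛ≤N = C.least (k + s) (cast
        (solve 2 (λ m r → # 2 :* m :+ r :+ # 2 :* r := # 2 :* (m :+ r) :+ r) refl m (+ r)) refl
        (0≤+ (floor-above m) s√4r≤2r))
        where
        s√4r≤2r : Nonneg (+ 2 * + r) s
        s√4r≤2r = inj₁ (*-nonneg (0≤ 2) 0≤r , ≡-nonneg
          (solve 2 (λ r s → # 4 :* (r :* (r :- s :* s))
              := # 2 :* r :* (# 2 :* r) :- # 4 :* r :* (s :* s)) refl (+ r) s)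
          (*-nonneg (0≤ 4) (*-nonneg 0≤r s²≤r)))

      N≤cₛ₊₂ : N ≤ c (k + + suc (suc (suc s′)))
      N≤cₛ₊₂ with N ℤₚ.≤? c (k + + suc (suc (suc s′)))
      ... | yes p = p
      -- Otherwise (k + s + 2)√r ≤ N - 1 + r/2, while m + r/2 ≤ (k + 1)√r; hence (s + 1)√r ≤ r - 1,
      -- against √r ≤ s + 1.
      ... | no ¬p = ⊥-elim (no-cancellation {x = - + 2} {y = + 2} (ι⁻¹ (cast
        (solve 2 (λ m r → # 2 :* (m :+ r :- # 1) :+ r :+ :- (# 2 :* m :+ r) :+ :- (# 2 :* r)
            := con (- + 2)) refl m (+ r))
        (solve 2 (λ k s → k :+ (# 2 :+ s) :+ :- (k :+ # 1) :+ :- (s :+ # 1) := # 0) refl k s)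
        (0≤+ (0≤+ (θ-mono (<-pred (ℤₚ.≰⇒> ¬p)) (C.above (k + + suc (suc (suc s′))))) (neg-nonneg (floor-maximal m))) 2r≤s+1√4r)))
        (+<+ (ℕ.s≤s ℕ.z≤n)) refl)
        where
        2r≤s+1√4r : Nonneg (- (+ 2 * + r)) (- (s + 1ℤ))
        2r≤s+1√4r = inj₂ (≡-nonneg (sym (ℤₚ.neg-involutive (s + 1ℤ))) (+≤+ ℕ.z≤n) , ≡-nonneg
          (solve 2 (λ r s → # 4 :* (r :* (s :* s :+ # 2 :* s :- r :+ # 1))
             
                  := :- (:- (# 2 :* r) :* :- (# 2 :* r) :- # 4 :* r :* (:- (s :+ # 1) :* :- (s :+ # 1))))
                  refl (+ r) s)
          (*-nonneg (0≤ 4) (*-nonneg 0≤r (+-nonneg r≤s²+2s (+≤+ ℕ.z≤n)))))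

      bound : Dec (N ≤ c (k + + suc (suc s′))) → Nonneg (- (+ 2 * T + + r)) (- N)
      bound (yes N≤cₛ₊₁) = cast
        (solve 7 (λ r s k m c₀ Σc T → # 2 :* (Σc :- s :* (c₀ :+ r) :- r :* k) :- r :+ (m :- c₀) :* :- (# 2 :* s)
            :+ # 2 :* ((m :+ r) :* (k :+ s) :- m :* k :- Σc :- T)
                := :- (# 2 :* T :+ r)) refl (+ r) s k m (c k) (csum k (suc s′)) T)
        (solve 3 (λ r m c₀ → :- (c₀ :+ r) :+ (m :- c₀) :* con -1ℤ :+ # 0 := :- (m :+ r)) refl (+ r) m (c k))
        (0≤+ (0≤+ (key-at k) (scale (ℤₚ.i≤j⇒0≤j-i (C.least k (floor-above m))) f))
          (ι (*-nonneg (0≤ 2) (block-bound m (suc s′) r cₛ≤N N≤cₛ₊₁))))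
      bound (no N≰cₛ₊₁) = cast
        (trans (cong (λ x → + 2 * (csum (k + 1ℤ) (suc s′) - s * (c (k + 1ℤ) + + r) - + r * (k + 1ℤ)) - + r + (c (k + 1ℤ) - m) * (+ 2 * s + + 2)
            + + 2 * (N * (k + + suc (suc s′)) - m * k - x - T)) (csum-shift k (suc s′)))
          (solve 7 (λ r s k m c₀ Σc T → # 2 :* (Σc :- s :* (c₀ :+ r) :- r :* (k :+ # 1)) :- r :+ (c₀ :- m) :* (# 2 :* s :+ # 2)
            :+ # 2 :* ((m :+ r) :* (k :+ (# 1 :+ s)) :- m :* k :- (c₀ :+ Σc) :- T)
                := :- (# 2 :* T :+ r)) refl (+ r) s k m (c (k + 1ℤ)) (csum (k + 1ℤ) (suc s′)) T))
        (solve 3 (λ r m c₀ → :- (c₀ :+ r) :+ (c₀ :- m) :* # 1 :+ # 0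
            := :- (m :+ r)) refl (+ r) m (c (k + 1ℤ)))
        (0≤+ (0≤+ (key-at (k + 1ℤ)) (scale (ℤₚ.i≤j⇒0≤j-i m≤c) g))
          (ι (*-nonneg (0≤ 2) (block-bound m (suc (suc s′)) r (ℤₚ.<⇒≤ (ℤₚ.≰⇒> N≰cₛ₊₁)) N≤cₛ₊₂))))
        where
        m≤c : m ≤ c (k + 1ℤ)
        m≤c with m ℤₚ.≤? c (k + 1ℤ)
        ... | yes p = p
        ... | no ¬p = contradiction (θ-mono (ℤₚ.<⇒≤ (ℤₚ.≰⇒> ¬p)) (C.above (k + 1ℤ))) (floor-maximal m)

-- Reflection of interval sums, and S as an interval sum

intervalSum-front : ∀ a m l → intervalSum a m (suc l) ≡ a m + intervalSum a (m + 1ℤ) l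
intervalSum-front a m zero    = trans (ℤₚ.+-comm 0ℤ (a (m + 0ℤ))) (cong (λ x → a x + 0ℤ) (ℤₚ.+-identityʳ m))
intervalSum-front a m (suc l) = trans
  (cong₂ _+_ (intervalSum-front a m l) (cong a (sym (ℤₚ.+-assoc m 1ℤ (+ l)))))
  (ℤₚ.+-assoc (a m) (intervalSum a (m + 1ℤ) l) (a (m + 1ℤ + + l)))

-- The map i ↦ e - i sends [m , m + l) onto [e + 1 - m - l , e + 1 - m), so l instances of the
-- hypothesis add up. The reflected interval grows at its front.
intervalSum-reflect : ∀ a e d → (∀ i → 0ℤ ≤ a i + a (e - i) + d) → ∀ m l →
  0ℤ ≤ intervalSum a m l + intervalSum a (e + 1ℤ - m - + l) l + + l * d
intervalSum-reflect a e d h m zero = ≡-nonneg (solve 1 (λ d → # 0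
    := # 0 :+ # 0 :+ # 0 :* d) refl d) ℤₚ.≤-refl
intervalSum-reflect a e d h m (suc l) = ≡-nonneg
  (trans (solve 6 (λ T T′ x y l d → T :+ T′ :+ l :* d :+ (x :+ y :+ d)
      := T :+ x :+ (y :+ T′) :+ (# 1 :+ l) :* d)
      refl (intervalSum a m l) (intervalSum a (e + 1ℤ - m - + l) l) (a (m + + l)) (a (e - (m + + l))) (+ l) d)
    (cong (λ x → intervalSum a m (suc l) + x + + suc l * d) (trans
      (cong₂ _+_
        (cong a (solve 3 (λ e m l → e :- (m :+ l) := e :+ # 1 :- m :- (# 1 :+ l)) refl e m (+ l)))
        (cong (λ x → intervalSum a x l) (solve 3 (λ e m l → e :+ # 1 :- m :- l
            := e :+ # 1 :- m :- (# 1 :+ l) :+ # 1) refl e m (+ l))))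
      (sym (intervalSum-front a (e + 1ℤ - m - + suc l) l)))))
  (+-nonneg (intervalSum-reflect a e d h m l) (h (m + + l)))

-- The list runs downwards from n, so its head is the last term of the interval. The function `f` is
-- arbitrary because the tail of `applyUpTo` shifts it.
sumℤ-applyUpTo : ∀ a l n f → (∀ j → f j ≡ a (n - + j)) → sumℤ (applyUpTo f l) ≡ intervalSum a (n + 1ℤ - + l) l
sumℤ-applyUpTo a zero    n f h = refl
sumℤ-applyUpTo a (suc l) n f h = trans
  (cong₂ _+_ (trans (h 0) (cong a (solve 2 (λ n l → n :- # 0 := n :+ # 1 :- (# 1 :+ l) :+ l) refl n (+ l))))
    (trans (sumℤ-applyUpTo a l (n - 1ℤ) (λ j → f (suc j)) (λ j → trans (h (suc j))
        (cong a (solve 2 (λ n j → n :- (# 1 :+ j) := n :- # 1 :- j) refl n (+ j)))))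
      (cong (λ m → intervalSum a m l) (solve 2 (λ n l → n :- # 1 :+ # 1 :- l
          := n :+ # 1 :- (# 1 :+ l)) refl n (+ l)))))
  (ℤₚ.+-comm (a (n + 1ℤ - + suc l + + l)) (intervalSum a (n + 1ℤ - + suc l) l))

S≡intervalSum : ∀ r a n → S r a n ≡ intervalSum a (n + 1ℤ - + r) r
S≡intervalSum r a n = trans (cong sumℤ (map-applyUpTo id (λ j → a (n - + j)) r))
  (sumℤ-applyUpTo a r n (λ j → a (n - + j)) (λ _ → refl))

-- Integer square roots and perfect squares

nat-sqrt : ∀ r → Σ ℕ λ s′ → let s = + suc s′ in 0ℤ ≤ + suc r - s * s × 0ℤ ≤ s * s + + 2 * s - + suc r
nat-sqrt zero = 0 ,
  ≡-nonneg (solve 0 (# 0 := # 1 :- # 1 :* # 1) refl) ℤₚ.≤-refl ,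
  ≡-nonneg (solve 0 (# 2 := # 1 :* # 1 :+ # 2 :* # 1 :- # 1) refl) (+≤+ ℕ.z≤n)
nat-sqrt (suc r) with nat-sqrt r
... | s′ , s²≤r , r≤s²+2s with 0≤-dec (+ suc s′ * + suc s′ + + 2 * + suc s′ - + suc (suc r))
...   | inj₁ p = s′ ,
  ≡-nonneg (solve 2 (λ r s → r :- s :* s :+ # 1
      := # 1 :+ r :- s :* s) refl (+ suc r) (+ suc s′)) (+-nonneg s²≤r (+≤+ ℕ.z≤n)) , p
...   | inj₂ p = suc s′ ,
  ≡-nonneg (solve 2 (λ r s → con -1ℤ :- (s :* s :+ # 2 :* s :- (# 1 :+ r))
      := # 1 :+ r :- (# 1 :+ s) :* (# 1 :+ s)) refl (+ suc r) (+ suc s′)) p ,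
  ≡-nonneg (solve 2 (λ r s → s :* s :+ # 2 :* s :- r :+ # 2 :* (# 1 :+ s)
      := (# 1 :+ s) :* (# 1 :+ s) :+ # 2 :* (# 1 :+ s) :- (# 1 :+ r)) refl (+ suc r) (+ suc s′))
    (+-nonneg r≤s²+2s (*-nonneg (0≤ 2) (0≤ suc (suc s′))))

-- Dividing by the gcd leaves coprime p and q with p² = r q²; then q divides p, so q = 1.
square-ratio : ∀ x y r .{{_ : NonZero y}} → x ℕ.* x ≡ r ℕ.* (y ℕ.* y) → Σ ℕ λ h → r ≡ h ℕ.* h × x ≡ h ℕ.* y
square-ratio x y r eq with gcd x y | gcd-GCD x y
... | d | isGCD with GCD.gcd∣m isGCD | GCD.gcd∣n isGCD
...   | divides p refl | divides q refl = p , r≡p² , cong (p ℕ.*_) (trans (sym (ℕₚ.*-identityˡ d)) (cong (ℕ._* d) (sym q≡1)))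
  where
  instance
    d≢0 : NonZero d
    d≢0 = ℕₚ.m*n≢0⇒n≢0 q
    d²≢0 : NonZero (d ℕ.* d)
    d²≢0 = ℕₚ.m*n≢0 d d
  coprime : Coprime p q
  coprime = GCD≡1⇒coprime (GCD-* (subst (GCD (p ℕ.* d) (q ℕ.* d)) (sym (ℕₚ.*-identityˡ d)) isGCD))
  p²≡rq² : p ℕ.* p ≡ r ℕ.* (q ℕ.* q)
  p²≡rq² = ℕₚ.*-cancelʳ-≡ (p ℕ.* p) (r ℕ.* (q ℕ.* q)) (d ℕ.* d)
    (trans (ℕₚ.[m*n]*[o*p]≡[m*o]*[n*p] p p d d) (trans eq
      (trans (cong (r ℕ.*_) (ℕₚ.[m*n]*[o*p]≡[m*o]*[n*p] q d q d)) (sym (ℕₚ.*-assoc r (q ℕ.* q) (d ℕ.* d))))))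
  q∣p : q ∣ p
  q∣p = coprime-divisor (λ (i∣q , i∣p) → coprime (i∣p , i∣q)) (divides (r ℕ.* q) (trans p²≡rq² (sym (ℕₚ.*-assoc r q q))))
  q≡1 : q ≡ 1
  q≡1 = coprime (q∣p , ∣-refl)
  r≡p² : r ≡ p ℕ.* p
  r≡p² = sym (trans p²≡rq² (trans (cong (λ q → r ℕ.* (q ℕ.* q)) q≡1) (ℕₚ.*-identityʳ r)))

2∣square⇒2∣ : ∀ h → 2 ∣ h ℕ.* h → 2 ∣ h
2∣square⇒2∣ h p = [ id , id ]′ (euclidsLemma h h prime[2] p)

-- If (2t + r)² = 4 r u², then r = h² and 2t + r = ±2hu, so that r, hence h, is even.
even-square : ∀ r t u → ¬ u ≡ 0ℤ → (+ 2 * t + + r) * (+ 2 * t + + r) - + 4 * + r * (u * u) ≡ 0ℤ → EvenSquare r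
even-square r t u u≢0 eq = h , r≡h² , 2∣square⇒2∣ h (subst (2 ∣_) r≡h² 2∣r)
  where
  x : ℤ
  x = + 2 * t + + r
  opaque
    unfolding _*_
    abs-eq : x * x ≡ + r * ((u * + 2) * (u * + 2)) → ∣ x ∣ ℕ.* ∣ x ∣ ≡ r ℕ.* ((∣ u ∣ ℕ.* 2) ℕ.* (∣ u ∣ ℕ.* 2))
    abs-eq h = trans (sym (ℤₚ.abs-* x x)) (trans (cong ∣_∣ h)
      (trans (ℤₚ.abs-* (+ r) ((u * + 2) * (u * + 2))) (cong (r ℕ.*_)
        (trans (ℤₚ.abs-* (u * + 2) (u * + 2)) (cong₂ ℕ._*_ (ℤₚ.abs-* u (+ 2)) (ℤₚ.abs-* u (+ 2)))))))
    2∣2t : + 2 ℤ∣.∣ + 2 * t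
    2∣2t = ℤ∣.∣m⇒∣m*n t ℤ∣.∣-refl
  instance
    2u≢0 : NonZero (∣ u ∣ ℕ.* 2)
    2u≢0 = ℕₚ.m*n≢0 ∣ u ∣ 2 {{ℕ.≢-nonZero (λ e → u≢0 (ℤₚ.∣i∣≡0⇒i≡0 e))}}
  ratio : Σ ℕ λ h → r ≡ h ℕ.* h × ∣ x ∣ ≡ h ℕ.* (∣ u ∣ ℕ.* 2)
  ratio = square-ratio ∣ x ∣ (∣ u ∣ ℕ.* 2) r (abs-eq (trans
    (solve 3 (λ x r u → x :* x
        := x :* x :- # 4 :* r :* (u :* u) :+ r :* (u :* # 2 :* (u :* # 2))) refl x (+ r) u)
    (trans (cong (λ y → y + + r * (u * + 2 * (u * + 2))) eq) (ℤₚ.+-identityˡ _))))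
  h : ℕ
  h = proj₁ ratio
  r≡h² : r ≡ h ℕ.* h
  r≡h² = proj₁ (proj₂ ratio)
  2∣x : + 2 ℤ∣.∣ x
  2∣x = ℤ∣.∣ᵤ⇒∣ (divides (h ℕ.* ∣ u ∣) (trans (proj₂ (proj₂ ratio)) (sym (ℕₚ.*-assoc h ∣ u ∣ 2))))
  2∣r : 2 ∣ r
  2∣r = ℤ∣.∣⇒∣ᵤ (ℤ∣.∣m+n∣m⇒∣n {m = + 2 * t} 2∣x 2∣2t)

-- Agreement with the comparison that defines the floor

module RealComparison (r : ℕ) (0<4r : 0ℤ < + 4 * + r) where
  open QuadraticOrder (+ 4 * + r) 0<4r

  private
    opaque
      unfolding _*_
      u²R≡ : ∀ u → u ℤ.* u ℤ.* + (4 ℕ.* r) ≡ + 4 * + r * (u * u)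
      u²R≡ u = trans (cong (u ℤ.* u ℤ.*_) (ℤₚ.pos-* 4 r)) (ℤₚ.*-comm (u ℤ.* u) (+ 4 ℤ.* + r))

    norm≡ : ∀ N u → N ℤ.* N - u ℤ.* u ℤ.* + (4 ℕ.* r) ≡ norm N u
    norm≡ N u = cong₂ _-_ (sym (*≡ N N)) (u²R≡ u)

    -norm≡ : ∀ N u → u ℤ.* u ℤ.* + (4 ℕ.* r) - N ℤ.* N ≡ - norm N u
    -norm≡ N u = trans (cong₂ _-_ (u²R≡ u) (sym (*≡ N N)))
      (solve 2 (λ x y → x :- y := :- (y :- x)) refl (+ 4 * + r * (u * u)) (N * N))

  LeMulSqrt⇒Nonneg : ∀ {u N} → LeMulSqrt (4 ℕ.* r) u N → Nonneg N u
  LeMulSqrt⇒Nonneg (inj₁ (u≤0 , 0≤N)) = both-nonneg 0≤N (ℤₚ.neg-mono-≤ u≤0)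
  LeMulSqrt⇒Nonneg {u} {N} (inj₂ (inj₁ (u≤0 , _ , h))) = inj₂ (ℤₚ.neg-mono-≤ u≤0 , ≡-nonneg (-norm≡ N u) (ℤₚ.i≤j⇒0≤j-i h))
  LeMulSqrt⇒Nonneg {u} {N} (inj₂ (inj₂ (_ , 0≤N , h))) = inj₁ (0≤N , ≡-nonneg (norm≡ N u) (ℤₚ.i≤j⇒0≤j-i h))

  Nonneg⇒LeMulSqrt : ∀ {u N} → Nonneg N u → LeMulSqrt (4 ℕ.* r) u N
  Nonneg⇒LeMulSqrt {u} {N} (inj₁ (0≤N , h)) with u ℤₚ.≤? 0ℤ
  ... | yes u≤0 = inj₁ (u≤0 , 0≤N)
  ... | no  u≰0 = inj₂ (inj₂ (ℤₚ.≰⇒> u≰0 , 0≤N , ℤₚ.0≤i-j⇒j≤i (≡-nonneg (sym (norm≡ N u)) h)))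
  Nonneg⇒LeMulSqrt {u} {N} (inj₂ (0≤-u , h)) with 0ℤ ℤₚ.≤? N
  ... | yes 0≤N = inj₁ (ℤₚ.neg-cancel-≤ 0≤-u , 0≤N)
  ... | no  0≰N = inj₂ (inj₁ (ℤₚ.neg-cancel-≤ 0≤-u , ℤₚ.≰⇒> 0≰N , ℤₚ.0≤i-j⇒j≤i (≡-nonneg (sym (-norm≡ N u)) h)))

-- The value of a at S n

module FloorSequence (r : ℕ) (2≤r : 2 ℕ.≤ r) (s′ : ℕ)
  (s²≤r : 0ℤ ≤ + r - + suc s′ * + suc s′) (r≤s²+2s : 0ℤ ≤ + suc s′ * + suc s′ + + 2 * + suc s′ - + r)
  (a : ℤ → ℤ) (isA : IsA r a) where

  open Upper r s′ (ℤₚ.i≤j⇒0≤j-i (+≤+ 2≤r)) s²≤r r≤s²+2s using (0<4r; upper-bound)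
  open QuadraticOrder (+ 4 * + r) 0<4r
  open RealComparison r 0<4r

  floor-above : ∀ n → Nonneg (+ 2 * n + + r) (a n)
  floor-above n = cast (cong (λ x → x + + r) (sym (*≡ (+ 2) n))) refl (LeMulSqrt⇒Nonneg (proj₁ (isA n)))

  floor-maximal : ∀ n → ¬ Nonneg (+ 2 * n + + r) (a n + 1ℤ)
  floor-maximal n p = proj₂ (isA n) (Nonneg⇒LeMulSqrt (cast (cong (λ x → x + + r) (*≡ (+ 2) n)) refl p))

  floor-greatest : ∀ {n k} → Nonneg (+ 2 * n + + r) k → k ≤ a n
  floor-greatest {n} {k} p with k ℤₚ.≤? a n
  ... | yes k≤a = k≤a
  ... | no  k≰a = contradiction (monoʳ (<-suc (ℤₚ.≰⇒> k≰a)) p) (floor-maximal n)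

  floor-unique : ∀ {n k} → Nonneg (+ 2 * n + + r) k → ¬ Nonneg (+ 2 * n + + r) (k + 1ℤ) → a n ≡ k
  floor-unique {n} {k} p ¬q with a n ℤₚ.≤? k
  ... | yes a≤k = ℤₚ.≤-antisym a≤k (floor-greatest p)
  ... | no  a≰k = contradiction (monoʳ (<-suc (ℤₚ.≰⇒> a≰k)) (floor-above n)) ¬q

  S-upper : ∀ n → Nonneg (- (+ 2 * S r a n + + r)) (- (n + 1ℤ))
  S-upper n = cast (cong (λ x → - (+ 2 * x + + r)) (sym (S≡intervalSum r a n)))
    (solve 2 (λ n r → :- (n :+ # 1 :- r :+ r) := :- (n :+ # 1)) refl n (+ r))
    (upper-bound a floor-above floor-maximal (n + 1ℤ - + r))

  -- Reflection takes the window of r indices ending at n to the one ending at e - 1 + r - n.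
  S-reflect : ∀ e d → (∀ i → 0ℤ ≤ a i + a (e - i) + d) → ∀ n → 0ℤ ≤ S r a n + S r a (e - 1ℤ + + r - n) + + r * d
  S-reflect e d h n = subst₂ (λ x y → 0ℤ ≤ x + y + + r * d) (sym (S≡intervalSum r a n))
    (trans (cong (λ m → intervalSum a m r) (solve 3 (λ e r n →
        e :+ # 1 :- (n :+ # 1 :- r) :- r := e :- # 1 :+ r :- n :+ # 1 :- r) refl e (+ r) n))
      (sym (S≡intervalSum r a (e - 1ℤ + + r - n))))
    (intervalSum-reflect a e d h (n + 1ℤ - + r) r)

  S-lower : ∀ n → Nonneg (+ 2 * S r a n + + r) n
  S-lower n = cast
    (solve 3 (λ r x y → :- (# 2 :* y :+ r) :+ # 2 :* (x :+ y :+ r :* # 1)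
        := # 2 :* x :+ r) refl (+ r) (S r a n) (S r a n′))
    (solve 2 (λ n r → :- (:- r :- # 1 :+ r :- n :+ # 1) :+ # 0 := n) refl n (+ r))
    (0≤+ (S-upper n′) (ι (*-nonneg (0≤ 2) (S-reflect (- + r) 1ℤ pair n))))
    where
    n′ : ℤ
    -- This is -n - 1, in the form that `S-reflect` produces.
    n′ = - + r - 1ℤ + + r - n
    -- i/√r + √r/2 and (-r - i)/√r + √r/2 are opposite numbers.
    pair : ∀ i → 0ℤ ≤ a i + a (- + r - i) + 1ℤ
    pair i = ≡-nonneg (solve 2 (λ x y → x :- :- (y :+ # 1) := x :+ y :+ # 1) refl (a i) (a (- + r - i)))
      (ℤₚ.i≤j⇒0≤j-i (floor-greatest (cast
        (solve 2 (λ r i → :- (# 2 :* (:- r :- i) :+ r) := # 2 :* i :+ r) refl (+ r) i) refl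
        (neg-nonneg (floor-maximal (- + r - i))))))

  generic : ¬ EvenSquare r → ∀ n → + r ≤ n → a (S r a n) ≡ n
  -- `p` opposes the upper bound, so 2 S n + r = (n + 1)√(4r). This constrains r because n + 1 is
  -- nonzero, which r ≤ n ensures.
  generic ¬even n r≤n = floor-unique (S-lower n) λ p →
    ¬even (even-square r (S r a n) (n + 1ℤ) n+1≢0 (antisym p (S-upper n)))
    where
    n+1≢0 : ¬ n + 1ℤ ≡ 0ℤ
    n+1≢0 = no-cancellation (ℤₚ.≤-trans (+≤+ ℕ.z≤n) r≤n) (+<+ (ℕ.s≤s ℕ.z≤n))

  -- For r = h² with h even, i/√r + √r/2 lies in ℤ/h, whence a(i) + a(h - 1 - r - i) = 0.
  even : ∀ h → + r ≡ + h * + h → 2 ∣ h → ∀ n → a (S r a n) ≡ n + 1ℤ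
  even h r≡h² (divides g h≡2g) n = floor-unique lower λ p → irrational>0 (cast
      (ℤₚ.+-inverseʳ (+ 2 * S r a n + + r)) (solve 1 (λ n → n :+ # 1 :+ # 1 :+ :- (n :+ # 1) := # 1) refl n)
      (0≤+ p (S-upper n)))
    where
    irrational>0 : ¬ Nonneg 0ℤ 1ℤ
    irrational>0 (inj₁ (_ , p)) = no-cancellation p 0<4r (solve 1 (λ R → # 0 :* # 0 :- R :* (# 1 :* # 1) :+ R
        := # 0) refl (+ 4 * + r))
    irrational>0 (inj₂ (() , _))
    H G : ℤ
    H = + h
    G = + g
    opaque
      unfolding _*_
      H≡2G : H ≡ G * + 2
      H≡2G = trans (cong +_ h≡2g) (ℤₚ.pos-* g 2)
    -- As √(4r) = 2h, this element is zero for u of either sign, and adding it trades √(4r) for 2h.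
    2h≡√4r : ∀ u → Nonneg (u * (+ 2 * H)) u
    2h≡√4r u with nonneg-total u
    ... | inj₁ 0≤u = inj₁ (*-nonneg 0≤u (*-nonneg (0≤ 2) (0≤ h)) , ≡-nonneg norm≡0 ℤₚ.≤-refl)
      where
      norm≡0 : 0ℤ ≡ norm (u * (+ 2 * H)) u
      norm≡0 = trans (solve 2 (λ u h → # 0
          := u :* (# 2 :* h) :* (u :* (# 2 :* h)) :- # 4 :* (h :* h) :* (u :* u)) refl u H)
        (cong (λ r → u * (+ 2 * H) * (u * (+ 2 * H)) - + 4 * r * (u * u)) (sym r≡h²))
    ... | inj₂ u≤0 = inj₂ (u≤0 , ≡-nonneg norm≡0 ℤₚ.≤-refl)
      where
      norm≡0 : 0ℤ ≡ - norm (u * (+ 2 * H)) u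
      norm≡0 = trans (solve 2 (λ u h → # 0
          := :- (u :* (# 2 :* h) :* (u :* (# 2 :* h)) :- # 4 :* (h :* h) :* (u :* u))) refl u H)
        (cong (λ r → - (u * (+ 2 * H) * (u * (+ 2 * H)) - + 4 * r * (u * u))) (sym r≡h²))
    pair : ∀ i → 0ℤ ≤ a i + a (H - 1ℤ - + r - i) + 0ℤ
    pair i with 0≤-dec (+ 2 * (H - 1ℤ - + r - i) + + r - (a (H - 1ℤ - + r - i) + 1ℤ) * (+ 2 * H))
    ... | inj₁ p = contradiction (cast
      (solve 2 (λ x y → x :- y :+ y
          := x) refl (+ 2 * (H - 1ℤ - + r - i) + + r) ((a (H - 1ℤ - + r - i) + 1ℤ) * (+ 2 * H)))
      (ℤₚ.+-identityˡ _) (0≤+ (ι p) (2h≡√4r (a (H - 1ℤ - + r - i) + 1ℤ)))) (floor-maximal (H - 1ℤ - + r - i))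
    ... | inj₂ p = ≡-nonneg (solve 2 (λ x y → x :- :- y
        := x :+ y :+ # 0) refl (a i) v) (ℤₚ.i≤j⇒0≤j-i (floor-greatest (cast
        (trans (solve 4 (λ i v h g → # 2 :* (i :+ v :* h :+ # 2 :* g :* g) :+ :- v :* (# 2 :* h)
            := # 2 :* i :+ g :* # 2 :* (g :* # 2)) refl i v H G)
          (cong (λ z → + 2 * i + z) (sym r≡4G²)))
        (ℤₚ.+-identityˡ (- v))
        (0≤+ (ι (*-nonneg (0≤ 2) 0≤y)) (2h≡√4r (- v))))))
      where
      v : ℤ
      v = a (H - 1ℤ - + r - i)
      r≡4G² : + r ≡ G * + 2 * (G * + 2)
      r≡4G² = trans r≡h² (cong₂ _*_ H≡2G H≡2G)
      0≤y : 0ℤ ≤ i + v * H + + 2 * G * G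
      -- Maximality of v gives 2(i + vh) + r + 1 ≥ 0. Since r = 4g² is even, the left side is 2y +
      -- 1, and integrality improves the bound to y ≥ 0.
      0≤y = half-nonneg (≡-nonneg
        (trans (solve 4 (λ h r i v → con -1ℤ :- (# 2 :* (h :- # 1 :- r :- i) :+ r :- (v :+ # 1) :* (# 2 :* h))
            := # 2 :* (i :+ v :* h) :+ r :+ # 1) refl H (+ r) i v)
          (trans (cong (λ r → + 2 * (i + v * H) + r + 1ℤ) r≡4G²)
            (solve 3 (λ x g h → # 2 :* x :+ g :* # 2 :* (g :* # 2) :+ # 1
                := # 2 :* (x :+ # 2 :* g :* g) :+ # 1) refl (i + v * H) G H))) p)
    n′ : ℤ
    -- This is h - 2 - n, where the upper bound is (h - 1 - n)√r; the part h√r = r turns r/2 into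
    -- -r/2.
    n′ = H - 1ℤ - + r - 1ℤ + + r - n
    lower : Nonneg (+ 2 * S r a n + + r) (n + 1ℤ)
    lower = cast
      (trans (solve 4 (λ r h x y → :- (# 2 :* y :+ r) :+ # 2 :* (x :+ y :+ r :* # 0) :+ h :* (# 2 :* h)
          := # 2 :* x :+ (h :* h :+ (h :* h :- r))) refl (+ r) H (S r a n) (S r a n′))
        (cong (λ z → + 2 * S r a n + z) (trans (cong (λ z → z + (z - + r)) (sym r≡h²)) (solve 1 (λ r → r :+ (r :- r)
            := r) refl (+ r)))))
      (solve 3 (λ n r h → :- (h :- # 1 :- r :- # 1 :+ r :- n :+ # 1) :+ # 0 :+ h
          := n :+ # 1) refl n (+ r) H)
      (0≤+ (0≤+ (S-upper n′) (ι (*-nonneg (0≤ 2) (S-reflect (H - 1ℤ - + r) 0ℤ pair n)))) (2h≡√4r H))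

odd⇒¬even : ∀ {r} → OddSquare r → ¬ EvenSquare r
odd⇒¬even (s , r≡s² , odd) (h , r≡h² , 2∣h) =
  odd (2∣square⇒2∣ s (subst (2 ∣_) (trans (sym r≡h²) r≡s²) (∣m⇒∣m*n h 2∣h)))

theorem3p1 : (r : ℕ) → 2 Data.Nat.≤ r → (a : ℤ → ℤ) → IsA r a →
    ((¬ EvenSquare r) → (n : ℤ) → + r ≤ n → a (S r a n) ≡ n)
    × (EvenSquare r → (n : ℤ) → + r ≤ n → a (S r a n) ≡ n + + 1)
    × (OddSquare r → (n : ℤ) → + r ≤ n → a (S r a n) ≡ n)
theorem3p1 (suc r) 2≤r a isA =
    generic
  , (λ (h , r≡h² , 2∣h) n _ → even h (trans (cong +_ r≡h²) (trans (ℤₚ.pos-* h h) (sym (*≡ (+ h) (+ h))))) 2∣h n)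
  , (λ odd → generic (odd⇒¬even odd))
  where
  s′ = nat-sqrt r
  open FloorSequence (suc r) 2≤r (proj₁ s′) (proj₁ (proj₂ s′)) (proj₂ (proj₂ s′)) a isA
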